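{- As $n\to\infty$, $g(n,K_3,\emptyset) = (1+o(1))\dfrac{n^3}{48}$.
   Context: The Constructor-Blocker game with parameters $n$, a graph $H$ and a family $\mathcal{F}$ of graphs: two players, Constructor and Blocker, alternately claim previously unclaimed edges of the complete graph $K_n$, Constructor moving first. Constructor may only claim an edge if afterwards her graph (the graph on $V(K_n)$ formed by the edges she has claimed) contains no subgraph isomorphic to a member of $\mathcal{F}$; Blocker may claim any unclaimed edge. The game ends when Constructor cannot claim any more edges or all edges are claimed. The score is the number of copies of $H$ (subgraphs isomorphic to $H$) in Constructor's graph at the end; Constructor aims to maximize it and Blocker to minimize it. $g(n,H,\mathcal{F})$ denotes the score under optimal play by both players; $g(n,H,F)$ is used when $\mathcal{F}=\{F\}$. Here $\mathcal{F}=\emptyset$, i.e. Constructor has no restriction, and $K_3$ is the triangle. -}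

module Defs where

open import Data.Nat using (ℕ; zero; suc; _⊔_; _⊓_)
open import Data.Bool using (Bool; true; false; _∧_; if_then_else_)
open import Data.Fin using (Fin; _<?_; _≟_)
open import Data.List using (List; []; _∷_; map; filter; length; cartesianProduct; concatMap; allFin)
open import Data.Product using (_×_; _,_)
open import Relation.Nullary.Decidable using (does; ⌊_⌋)

data Owner : Set where
  free con blo : Owner

data Player : Set where
  Constructor Blocker : Player

-- A board: owner of edge {i,j}; only consulted with i < j (as Fin).
Board : ℕ → Set
Board n = Fin n → Fin n → Owner

emptyBoard : ∀ {n} → Board n
emptyBoard _ _ = free

isFree : Owner → Bool
isFree free = true
isFree _    = false

isCon : Owner → Bool
isCon con = true
isCon _   = false

Edge : ℕ → Set
Edge n = Fin n × Fin n

edges : (n : ℕ) → List (Edge n)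
edges n = filter (λ { (i , j) → i <? j }) (cartesianProduct (allFin n) (allFin n))

claim : ∀ {n} → Board n → Edge n → Owner → Board n
claim b (i , j) o x y = if ⌊ x ≟ i ⌋ ∧ ⌊ y ≟ j ⌋ then o else b x y

freeEdges : ∀ {n} → Board n → List (Edge n)
freeEdges {n} b = filter (λ { (i , j) → Data.Bool._≟_ (isFree (b i j)) true }) (edges n)

legalConMoves : ∀ {n} → (Board n → Bool) → Board n → List (Edge n)
legalConMoves legal b = filter (λ e → Data.Bool._≟_ (legal (claim b e con)) true) (freeEdges b)

triples : (n : ℕ) → List (Fin n × Fin n × Fin n)
triples n = concatMap (λ { (i , j) → map (λ k → (i , j , k)) (filter (λ k → j <? k) (allFin n)) }) (edges n)

triangleCount : ∀ {n} → Board n → ℕ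
triangleCount {n} b =
  length (filter (λ { (i , j , k) → Data.Bool._≟_ (isCon (b i j) ∧ isCon (b j k) ∧ isCon (b i k)) true }) (triples n))

maxList : List ℕ → ℕ
maxList []       = 0
maxList (x ∷ xs) = x ⊔ maxList xs

minList : List ℕ → ℕ
minList []       = 0
minList (x ∷ []) = x
minList (x ∷ y ∷ xs) = x ⊓ minList (y ∷ xs)

-- Minimax value of the Constructor-Blocker game with fuel f (number of moves still allowed),
-- Constructor's legality predicate `legal` and score function `score`.
-- The game ends when the player to move has no legal move (Constructor: no legal move;
-- Blocker: no free edge).  Fuel = number of edges of K_n suffices, since each move claims an edge.
value : ∀ {n} → (Board n → Bool) → (Board n → ℕ) → ℕ → Player → Board n → ℕ
value legal score zero    _ b = score b
value legal score (suc f) Constructor b with legalConMoves legal b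
... | []       = score b
... | (e ∷ es) = maxList (map (λ e′ → value legal score f Blocker (claim b e′ con)) (e ∷ es))
value legal score (suc f) Blocker b with freeEdges b
... | []       = score b
... | (e ∷ es) = minList (map (λ e′ → value legal score f Constructor (claim b e′ blo)) (e ∷ es))

-- g(n, K_3, ∅): the family ∅ imposes no restriction, so every free edge is legal for Constructor.
gTriangleEmpty : ℕ → ℕ
gTriangleEmpty n = value {n} (λ _ → true) triangleCount (length (edges n)) Constructor emptyBoard

{-# OPTIONS --safe #-}
-- Weight a triangle by the product over its edges of 2 (claimed by Constructor), 1 (free),
-- 0 (claimed by Blocker), and let Φ be the total weight, so that Φ = C(n,3) initially and
-- Φ = 8 · score at the end.  Claiming a free edge e changes Φ by ± D(e), where D(e) is the sum
-- of the products of the other two weights over the triangles through e; both players greedily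
-- maximize D.  Claims by Blocker never increase D, so by the pairing of Erdős and Selfridge only
-- Constructor's first move, of value O(n), can raise Φ above its initial value.  A claim of e by
-- Constructor raises D(f) only through triangles containing both e and f, hence by O(1), and
-- over the O(n²) rounds Constructor loses O(n²).  So 8 g = C(n,3) + O(n²).
module Submission where

open import Defs
open import Data.Bool using (Bool; true; false; _∧_; if_then_else_)
open import Data.Fin using (Fin; zero; suc; _≟_)
import Data.Fin as Fin
import Data.Fin.Properties as Fin
open import Data.List
  using (List; []; _∷_; _++_; map; filter; length; cartesianProduct; concatMap; allFin)
open import Data.List.Extrema.Nat using (argmax; argmax-sel; f[xs]≤f[argmax]; f[⊥]≤f[argmax])
open import Data.List.Membership.Propositional using (_∈_; _∉_; find; lose)
open import Data.List.Membership.Propositional.Properties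
  using (∈-filter⁺; ∈-filter⁻; ∈-map⁻; ∈-concatMap⁺; ∈-concatMap⁻;
         ∈-cartesianProduct⁺; ∈-allFin; ∈-∃++; ∈-++⁺ˡ; ∈-++⁺ʳ; ∈-++⁻)
open import Data.List.Properties using (length-++; length-filter; length-tabulate; map-∘; map-++; map-tabulate)
open import Data.List.Relation.Unary.All as All using ([]; _∷_)
open import Data.List.Relation.Unary.AllPairs as AllPairs using ([]; _∷_)
import Data.List.Relation.Unary.All.Properties as All
import Data.List.Relation.Unary.AllPairs.Properties as AllPairs
open import Data.List.Relation.Binary.Disjoint.Propositional using (Disjoint)
open import Data.List.Relation.Unary.Any as Any using (here; there)
open import Data.List.Relation.Unary.Unique.Propositional using (Unique)
import Data.List.Relation.Unary.Unique.Propositional.Properties as Unique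
open import Data.Nat
  using (ℕ; zero; suc; _+_; _*_; _^_; _≤_; _<_; z≤n; s≤s; s≤s⁻¹; ∣_-_∣)
open import Data.Nat.ListAction using (sum; product)
open import Data.Nat.ListAction.Properties using (sum-++)
open import Data.Nat.Properties hiding (_≟_)
open import Data.Nat.Tactic.RingSolver using (solve-∀)
open import Data.Product using (Σ; ∃; _×_; _,_; proj₁; proj₂)
open import Data.Product.Properties using (≡-dec)
open import Data.Sum using (_⊎_; inj₁; inj₂; [_,_]′)
open import Function using (_∘_; id)
open import Level using (Level)
open import Relation.Binary using (DecidableEquality)
open import Relation.Binary.PropositionalEquality
  using (_≡_; _≢_; refl; sym; trans; cong; cong₂; subst)
open import Relation.Nullary using (¬_; Dec; yes; no; does; contradiction)
open import Relation.Unary using (Pred; Decidable)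

private
  variable
    ℓ : Level
    A B : Set
    P Q : Pred A ℓ
    n : ℕ

-- Finite sums over lists.

∑ : List A → (A → ℕ) → ℕ
∑ xs f = sum (map f xs)

∑-mono : (xs : List A) {f g : A → ℕ} → (∀ {x} → x ∈ xs → f x ≤ g x) → ∑ xs f ≤ ∑ xs g
∑-mono []       f≤g = z≤n
∑-mono (x ∷ xs) f≤g = +-mono-≤ (f≤g (here refl)) (∑-mono xs (f≤g ∘ there))

∑-cong : (xs : List A) {f g : A → ℕ} → (∀ {x} → x ∈ xs → f x ≡ g x) → ∑ xs f ≡ ∑ xs g
∑-cong []       f≡g = refl
∑-cong (x ∷ xs) f≡g = cong₂ _+_ (f≡g (here refl)) (∑-cong xs (f≡g ∘ there))

∑-+ : (xs : List A) (f g : A → ℕ) → ∑ xs (λ x → f x + g x) ≡ ∑ xs f + ∑ xs g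
∑-+ []       f g = refl
∑-+ (x ∷ xs) f g rewrite ∑-+ xs f g = interchange (f x) (g x) (∑ xs f) (∑ xs g)
  where
  interchange : ∀ a b c d → a + b + (c + d) ≡ a + c + (b + d)
  interchange = solve-∀

∑-1 : (xs : List A) → ∑ xs (λ _ → 1) ≡ length xs
∑-1 []       = refl
∑-1 (x ∷ xs) = cong suc (∑-1 xs)

∑-map : (h : A → B) (xs : List A) (f : B → ℕ) → ∑ (map h xs) f ≡ ∑ xs (f ∘ h)
∑-map h xs f = cong sum (sym (map-∘ xs))

∑-++ : (xs ys : List A) (f : A → ℕ) → ∑ (xs ++ ys) f ≡ ∑ xs f + ∑ ys f
∑-++ xs ys f = trans (cong sum (map-++ f xs ys)) (sum-++ (map f xs) (map f ys))

∑-concatMap : (h : A → List B) (xs : List A) (f : B → ℕ) →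
  ∑ (concatMap h xs) f ≡ ∑ xs (λ x → ∑ (h x) f)
∑-concatMap h []       f = refl
∑-concatMap h (x ∷ xs) f =
  trans (∑-++ (h x) (concatMap h xs) f) (cong (∑ (h x) f +_) (∑-concatMap h xs f))

∑-cartesianProduct : (xs : List A) (ys : List B) (f : A × B → ℕ) →
  ∑ (cartesianProduct xs ys) f ≡ ∑ xs (λ x → ∑ ys (λ y → f (x , y)))
∑-cartesianProduct []       ys f = refl
∑-cartesianProduct (x ∷ xs) ys f = trans (∑-++ (map (x ,_) ys) (cartesianProduct xs ys) f)
  (cong₂ _+_ (∑-map (x ,_) ys f) (∑-cartesianProduct xs ys f))

∑-filter : (P? : Decidable P) (xs : List A) (f : A → ℕ) →
  ∑ (filter P? xs) f ≡ ∑ xs (λ x → if does (P? x) then f x else 0)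
∑-filter P? []       f = refl
∑-filter P? (x ∷ xs) f with does (P? x)
... | true  = cong (f x +_) (∑-filter P? xs f)
... | false = ∑-filter P? xs f

*length-filter≤∑ : (P? : Decidable P) (c : ℕ) (xs : List A) {f : A → ℕ} →
  (∀ {x} → x ∈ xs → P x → c ≤ f x) → c * length (filter P? xs) ≤ ∑ xs f
*length-filter≤∑ P? c []       c≤f = ≤-reflexive (*-zeroʳ c)
*length-filter≤∑ P? c (x ∷ xs) c≤f with P? x
... | yes px = ≤-trans (≤-reflexive (*-suc c _))
  (+-mono-≤ (c≤f (here refl) px) (*length-filter≤∑ P? c xs (c≤f ∘ there)))
... | no  _  = m≤n⇒m≤o+n _ (*length-filter≤∑ P? c xs (c≤f ∘ there))

∑≤*length-filter : (P? : Decidable P) (c : ℕ) (xs : List A) {f : A → ℕ} →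
  (∀ {x} → x ∈ xs → f x ≤ c) → (∀ {x} → x ∈ xs → ¬ P x → f x ≤ 0) →
  ∑ xs f ≤ c * length (filter P? xs)
∑≤*length-filter P? c []       f≤c f≤0 = z≤n
∑≤*length-filter P? c (x ∷ xs) f≤c f≤0 with P? x
... | yes px = ≤-trans
  (+-mono-≤ (f≤c (here refl)) (∑≤*length-filter P? c xs (f≤c ∘ there) (f≤0 ∘ there)))
  (≤-reflexive (sym (*-suc c _)))
... | no ¬px = +-mono-≤ (f≤0 (here refl) ¬px) (∑≤*length-filter P? c xs (f≤c ∘ there) (f≤0 ∘ there))

-- Strictness comes from the single witness `x`, which passes only the second test. This makes the
-- number of free edges drop with every claim.
length-filter-< : (P? : Decidable P) (Q? : Decidable Q) → (∀ {x} → P x → Q x) →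
  ∀ {x} (xs : List A) → x ∈ xs → ¬ P x → Q x → length (filter P? xs) < length (filter Q? xs)
length-filter-< P? Q? P⊆Q (x ∷ xs) (here refl) ¬px qx with P? x | Q? x
... | yes px | _      = contradiction px ¬px
... | no _   | no ¬qx = contradiction qx ¬qx
... | no _   | yes _  = s≤s (filter-≤ xs)
  where
  filter-≤ : ∀ ys → length (filter P? ys) ≤ length (filter Q? ys)
  filter-≤ []       = z≤n
  filter-≤ (y ∷ ys) with P? y | Q? y
  ... | yes _  | yes _  = s≤s (filter-≤ ys)
  ... | yes py | no ¬qy = contradiction (P⊆Q py) ¬qy
  ... | no _   | yes _  = m≤n⇒m≤1+n (filter-≤ ys)
  ... | no _   | no _   = filter-≤ ys
length-filter-< P? Q? P⊆Q (y ∷ xs) (there x∈xs) ¬px qx with P? y | Q? y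
... | yes _  | yes _  = s≤s (length-filter-< P? Q? P⊆Q xs x∈xs ¬px qx)
... | yes py | no ¬qy = contradiction (P⊆Q py) ¬qy
... | no _   | yes _  = m≤n⇒m≤1+n (length-filter-< P? Q? P⊆Q xs x∈xs ¬px qx)
... | no _   | no _   = length-filter-< P? Q? P⊆Q xs x∈xs ¬px qx

-- Since `xs` has no repetitions, each entry of `es` is charged the excess `c` at most once. The
-- list `es` is arbitrary, so a crude overlist can serve as the set of exceptions.
∑-≤-except : DecidableEquality A → (c : ℕ) (xs es : List A) {f g : A → ℕ} → Unique xs →
  (∀ {x} → x ∈ xs → x ∉ es → f x ≤ g x) → (∀ {x} → x ∈ xs → f x ≤ g x + c) →
  ∑ xs f ≤ ∑ xs g + length es * c
∑-≤-except _≟ᴬ_ c []       es          _              f≤g f≤g+c = z≤n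
∑-≤-except _≟ᴬ_ c (x ∷ xs) es {f} {g} (x∉xs ∷ xs!) f≤g f≤g+c with Any.any? (x ≟ᴬ_) es
... | no x∉es = ≤-trans
  (+-mono-≤ (f≤g (here refl) x∉es) (∑-≤-except _≟ᴬ_ c xs es xs! (f≤g ∘ there) (f≤g+c ∘ there)))
  (≤-reflexive (sym (+-assoc (g x) _ _)))
-- The charged entry leaves `es`. The rest of `xs` avoids `x`, so lying outside the shortened list
-- still means lying outside `es`.
... | yes x∈es with ys , zs , refl ← ∈-∃++ x∈es = ≤-trans
  (+-mono-≤ (f≤g+c (here refl)) (∑-≤-except _≟ᴬ_ c xs (ys ++ zs) xs! f≤g′ (f≤g+c ∘ there)))
  (≤-reflexive eq)
  where
  f≤g′ : ∀ {y} → y ∈ xs → y ∉ ys ++ zs → f y ≤ g y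
  f≤g′ {y} y∈xs y∉ = f≤g (there y∈xs) y∉es
    where
    y∉es : y ∉ ys ++ x ∷ zs
    y∉es y∈es with ∈-++⁻ ys y∈es
    ... | inj₁ y∈ys          = y∉ (∈-++⁺ˡ y∈ys)
    ... | inj₂ (here refl)   = All.lookup x∉xs y∈xs refl
    ... | inj₂ (there y∈zs)  = y∉ (∈-++⁺ʳ ys y∈zs)
  rearrange : ∀ a c s p q → a + c + (s + (p + q) * c) ≡ a + s + (p + (1 + q)) * c
  rearrange = solve-∀
  eq : g x + c + (∑ xs g + length (ys ++ zs) * c) ≡ g x + ∑ xs g + length (ys ++ x ∷ zs) * c
  eq rewrite length-++ ys {zs} | length-++ ys {x ∷ zs} = rearrange (g x) c (∑ xs g) (length ys) (length zs)

-- Counting edges and triples by binomial coefficients.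

peel : (n : ℕ) (f : Fin (suc n) → ℕ) → ∑ (allFin (suc n)) f ≡ f zero + ∑ (allFin n) (f ∘ suc)
peel n f = cong (f zero +_)
  (trans (cong (λ xs → ∑ xs f) (sym (map-tabulate id suc))) (∑-map suc (allFin n) f))

-- A Boolean test in place of a filtered list: after `peel` the comparisons with `zero` and between
-- successors reduce by computation.
∑-above : Fin n → (Fin n → ℕ) → ℕ
∑-above {n} i f = ∑ (allFin n) (λ j → if does (i Fin.<? j) then f j else 0)

∑-above-zero : (f : Fin (suc n) → ℕ) → ∑-above zero f ≡ ∑ (allFin n) (f ∘ suc)
∑-above-zero {n} f = peel n (λ j → if does (zero {n} Fin.<? j) then f j else 0)

∑-above-suc : (i : Fin n) (f : Fin (suc n) → ℕ) → ∑-above (suc i) f ≡ ∑-above i (f ∘ suc)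
∑-above-suc {n} i f = peel n (λ j → if does (suc i Fin.<? j) then f j else 0)

∑-above-cong : (i : Fin n) {f g : Fin n → ℕ} → (∀ j → f j ≡ g j) → ∑-above i f ≡ ∑-above i g
∑-above-cong {n} i f≡g =
  ∑-cong (allFin n) (λ {j} _ → cong (λ c → if does (i Fin.<? j) then c else 0) (f≡g j))

countAbove : (n : ℕ) → Fin n → ℕ
countAbove n i = ∑-above i (λ _ → 1)

countPairsAbove : (n : ℕ) → Fin n → ℕ
countPairsAbove n i = ∑-above i (countAbove n)

countAbove-suc : (i : Fin n) → countAbove (suc n) (suc i) ≡ countAbove n i
countAbove-suc i = ∑-above-suc i (λ _ → 1)

∑-countAbove-suc : ∀ n →
  ∑ (allFin (suc n)) (countAbove (suc n)) ≡ n + ∑ (allFin n) (countAbove n)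
∑-countAbove-suc n = trans (peel n (countAbove (suc n))) (cong₂ _+_
  (trans (∑-above-zero {n} (λ _ → 1)) (trans (∑-1 (allFin n)) (length-tabulate {n = n} id)))
  (∑-cong (allFin n) λ {i} _ → countAbove-suc i))

-- Pascal's rule: an increasing triple either starts at `zero`, leaving a pair among the other
-- elements, or avoids `zero`.
∑-countPairsAbove-suc : ∀ n → ∑ (allFin (suc n)) (countPairsAbove (suc n)) ≡
  ∑ (allFin n) (countAbove n) + ∑ (allFin n) (countPairsAbove n)
∑-countPairsAbove-suc n = trans (peel n (countPairsAbove (suc n))) (cong₂ _+_
  (trans (∑-above-zero (countAbove (suc n))) (∑-cong (allFin n) λ {i} _ → countAbove-suc i))
  (∑-cong (allFin n) λ {i} _ →
    trans (∑-above-suc i (countAbove (suc n))) (∑-above-cong i countAbove-suc)))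

2*∑-countAbove : ∀ n → 2 * ∑ (allFin n) (countAbove n) + n ≡ n * n
2*∑-countAbove zero    = refl
2*∑-countAbove (suc n) rewrite ∑-countAbove-suc n =
  trans (regroup n (∑ (allFin n) (countAbove n))) (trans (cong (_+ (2 * n + 1)) (2*∑-countAbove n)) (square n))
  where
  regroup : ∀ n s → 2 * (n + s) + suc n ≡ 2 * s + n + (2 * n + 1)
  regroup = solve-∀
  square : ∀ n → n * n + (2 * n + 1) ≡ suc n * suc n
  square = solve-∀

-- This is 6 C(n,3) = n(n-1)(n-2) = n³ - 3n² + 2n with the negative term moved across.
6*∑-countPairsAbove : ∀ n →
  6 * ∑ (allFin n) (countPairsAbove n) + 3 * (n * n) ≡ n * (n * n) + 2 * n
6*∑-countPairsAbove zero    = refl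
-- Adding `3 * n` to both sides lets three copies of the identity for pairs be substituted without
-- subtraction.
6*∑-countPairsAbove (suc n) rewrite ∑-countPairsAbove-suc n = +-cancelʳ-≡ (3 * n) _ _
  (trans (regroup n s t)
  (trans (cong₂ (λ u v → 3 * u + v + (6 * n + 3)) (2*∑-countAbove n) (6*∑-countPairsAbove n)) (cube n)))
  where
  s = ∑ (allFin n) (countAbove n)
  t = ∑ (allFin n) (countPairsAbove n)
  regroup : ∀ n s t → 6 * (s + t) + 3 * (suc n * suc n) + 3 * n ≡
    3 * (2 * s + n) + (6 * t + 3 * (n * n)) + (6 * n + 3)
  regroup = solve-∀
  cube : ∀ n → 3 * (n * n) + (n * (n * n) + 2 * n) + (6 * n + 3) ≡
    suc n * (suc n * suc n) + 2 * suc n + 3 * n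
  cube = solve-∀

∑-edges : ∀ n (f : Edge n → ℕ) →
  ∑ (edges n) f ≡ ∑ (allFin n) (λ i → ∑-above i (λ j → f (i , j)))
∑-edges n f = trans (∑-filter _ (cartesianProduct (allFin n) (allFin n)) f)
  (∑-cartesianProduct (allFin n) (allFin n) (λ (i , j) → if does (i Fin.<? j) then f (i , j) else 0))

length-edges : ∀ n → length (edges n) ≡ ∑ (allFin n) (countAbove n)
length-edges n = trans (sym (∑-1 (edges n))) (∑-edges n (λ _ → 1))

length-triples : ∀ n → length (triples n) ≡ ∑ (allFin n) (countPairsAbove n)
length-triples n = trans (sym (∑-1 (triples n)))
  (trans (∑-concatMap _ (edges n) (λ _ → 1))
  (trans (∑-cong (edges n) λ {e} _ → count-extensions (proj₁ e) (proj₂ e))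
  (∑-edges n (countAbove n ∘ proj₂))))
  where
  count-extensions : (i j : Fin n) →
    ∑ (map (λ k → i , j , k) (filter (j Fin.<?_) (allFin n))) (λ _ → 1) ≡ countAbove n j
  count-extensions i j = trans (∑-map (λ k → i , j , k) (filter (j Fin.<?_) (allFin n)) (λ _ → 1))
    (∑-filter (j Fin.<?_) (allFin n) (λ _ → 1))

length-edges-≤ : ∀ n → length (edges n) ≤ n * n
length-edges-≤ n rewrite length-edges n =
  ≤-trans (m≤n*m s 2) (≤-trans (m≤m+n (2 * s) n) (≤-reflexive (2*∑-countAbove n)))
  where s = ∑ (allFin n) (countAbove n)

-- Triples, their edges, and the triples through given edges.

Triple : ℕ → Set
Triple n = Fin n × Fin n × Fin n

_≟ₑ_ : DecidableEquality (Edge n)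
_≟ₑ_ = ≡-dec _≟_ _≟_

edgesOf : Triple n → List (Edge n)
edgesOf (i , j , k) = (i , j) ∷ (j , k) ∷ (i , k) ∷ []

∈-triples⁻ : {i j k : Fin n} → (i , j , k) ∈ triples n → i Fin.< j × j Fin.< k
∈-triples⁻ {n} {i} {j} {k} T∈
  with (_ , _) , e∈ , T∈′ ← find (∈-concatMap⁻ _ {xs = edges n} T∈)
  with _ , k∈ , refl ← ∈-map⁻ _ T∈′
  = proj₂ (∈-filter⁻ _ {xs = cartesianProduct (allFin n) (allFin n)} e∈)
  , proj₂ (∈-filter⁻ _ {xs = allFin n} k∈)

∈-edges⁺ : {i j : Fin n} → i Fin.< j → (i , j) ∈ edges n
∈-edges⁺ i<j = ∈-filter⁺ _ (∈-cartesianProduct⁺ (∈-allFin _) (∈-allFin _)) i<j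

edgesOf⊆edges : {T : Triple n} {e : Edge n} → T ∈ triples n → e ∈ edgesOf T → e ∈ edges n
edgesOf⊆edges {T = i , j , k} T∈ e∈ with i<j , j<k ← ∈-triples⁻ T∈ | e∈
... | here refl                 = ∈-edges⁺ i<j
... | there (here refl)         = ∈-edges⁺ j<k
... | there (there (here refl)) = ∈-edges⁺ (Fin.<-trans i<j j<k)

edgesOf-unique : {T : Triple n} → T ∈ triples n → Unique (edgesOf T)
edgesOf-unique {T = i , j , k} T∈ with i<j , j<k ← ∈-triples⁻ T∈ =
  ((λ eq → Fin.<⇒≢ i<j (cong proj₁ eq)) ∷ (λ eq → Fin.<⇒≢ j<k (cong proj₂ eq)) ∷ []) ∷
  ((λ eq → Fin.<⇒≢ i<j (sym (cong proj₁ eq))) ∷ []) ∷ [] ∷ []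

-- A triple records the edge it was built from as its first two entries, so the blocks of different
-- edges are disjoint.
triples-unique : ∀ n → Unique (triples n)
triples-unique n = Unique.concat⁺
  (All.map⁺ (All.universal
    (λ _ → Unique.map⁺ (cong (proj₂ ∘ proj₂)) (Unique.filter⁺ _ (Unique.allFin⁺ n))) (edges n)))
  (AllPairs.map⁺ (AllPairs.map (λ e≢f {_} → disjoint e≢f)
    (Unique.filter⁺ _ (Unique.cartesianProduct⁺ (Unique.allFin⁺ n) (Unique.allFin⁺ n)))))
  where
  disjoint : {e f : Edge n} → e ≢ f → {ks ls : List (Fin n)} →
    Disjoint (map (λ k → proj₁ e , proj₂ e , k) ks) (map (λ k → proj₁ f , proj₂ f , k) ls)
  disjoint e≢f (T∈e , T∈f) with _ , _ , refl ← ∈-map⁻ _ T∈e | _ , _ , refl ← ∈-map⁻ _ T∈f = e≢f refl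

-- The new vertex is tried in all three positions regardless of order. This overlist of the triples
-- through an edge serves only as an exception list in `∑-≤-except`.
completions : Edge n → List (Fin n) → List (Triple n)
completions (a , b) = concatMap (λ x → (x , a , b) ∷ (a , x , b) ∷ (a , b , x) ∷ [])

length-completions : (e : Edge n) (xs : List (Fin n)) → length (completions e xs) ≡ length xs * 3
length-completions e []       = refl
length-completions e (x ∷ xs) = cong (3 +_) (length-completions e xs)

∈-completions-allFin : {T : Triple n} {e : Edge n} → e ∈ edgesOf T → T ∈ completions e (allFin n)
∈-completions-allFin {n} {T = i , j , k} e∈ with e∈
... | here refl                 = ∈-concatMap⁺ _ (lose (∈-allFin k) (there (there (here refl))))
... | there (here refl)         = ∈-concatMap⁺ _ (lose (∈-allFin i) (here refl))
... | there (there (here refl)) = ∈-concatMap⁺ _ (lose (∈-allFin j) (there (here refl)))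

-- The vertex of the triangle off `e` must lie on any other edge `f` of it. So two candidate
-- vertices in three positions, six triples in all, suffice.
∈-completions-edge : {T : Triple n} {e f : Edge n} → e ≢ f → e ∈ edgesOf T → f ∈ edgesOf T →
  T ∈ completions e (proj₁ f ∷ proj₂ f ∷ [])
∈-completions-edge e≢f (here refl) (here refl) = contradiction refl e≢f
∈-completions-edge e≢f (here refl) (there (here refl)) = there (there (there (there (there (here refl)))))
∈-completions-edge e≢f (here refl) (there (there (here refl))) = there (there (there (there (there (here refl)))))
∈-completions-edge e≢f (there (here refl)) (here refl) = here refl
∈-completions-edge e≢f (there (here refl)) (there (here refl)) = contradiction refl e≢f
∈-completions-edge e≢f (there (here refl)) (there (there (here refl))) = here refl
∈-completions-edge e≢f (there (there (here refl))) (here refl) = there (there (there (there (here refl))))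
∈-completions-edge e≢f (there (there (here refl))) (there (here refl)) = there (here refl)
∈-completions-edge e≢f (there (there (here refl))) (there (there (here refl))) = contradiction refl e≢f

-- The potential and the weight of a single triple.

-- Twice the probability that the edge ends up Constructor's if free edges are decided by fair
-- coin tosses.
ω : Owner → ℕ
ω con  = 2
ω free = 1
ω blo  = 0

owner : Board n → Edge n → Owner
owner b (i , j) = b i j

weight : Board n → List (Edge n) → ℕ
weight b es = product (map (ω ∘ owner b) es)

-- Eight times the expected final number of Constructor's triangles under those coin tosses.
Φ : Board n → ℕ
Φ {n} b = ∑ (triples n) (weight b ∘ edgesOf)

owner-claim-≡ : (b : Board n) (e : Edge n) (o : Owner) → owner (claim b e o) e ≡ o
owner-claim-≡ b (i , j) o with i ≟ i | j ≟ j
... | yes _  | yes _  = refl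
... | no i≢i | _      = contradiction refl i≢i
... | yes _  | no j≢j = contradiction refl j≢j

owner-claim-≢ : (b : Board n) {e p : Edge n} (o : Owner) → p ≢ e →
  owner (claim b e o) p ≡ owner b p
owner-claim-≢ b {i , j} {x , y} o p≢e with x ≟ i | y ≟ j
... | yes refl | yes refl = contradiction refl p≢e
... | yes _    | no _     = refl
... | no _     | _        = refl

weight-claim-∉ : (b : Board n) {e : Edge n} (o : Owner) (es : List (Edge n)) → e ∉ es →
  weight (claim b e o) es ≡ weight b es
weight-claim-∉ b o []       e∉es = refl
weight-claim-∉ b o (p ∷ es) e∉es = cong₂ _*_
  (cong ω (owner-claim-≢ b o (e∉es ∘ here ∘ sym))) (weight-claim-∉ b o es (e∉es ∘ there))

weight-claim-claim-∉ : (b : Board n) {f : Edge n} (o : Owner) (e : Edge n) (o′ : Owner)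
  (es : List (Edge n)) → f ∉ es →
  weight (claim (claim b f o) e o′) es ≡ weight (claim b e o′) es
weight-claim-claim-∉ b o e o′ []       f∉es = refl
weight-claim-claim-∉ b {f} o e o′ (p ∷ es) f∉es = cong₂ _*_
  (cong ω owner-agree) (weight-claim-claim-∉ b o e o′ es (f∉es ∘ there))
  where
  owner-agree : owner (claim (claim b f o) e o′) p ≡ owner (claim b e o′) p
  owner-agree with p ≟ₑ e
  ... | yes refl = trans (owner-claim-≡ (claim b f o) e o′) (sym (owner-claim-≡ b e o′))
  ... | no p≢e   = trans (owner-claim-≢ (claim b f o) o′ p≢e)
    (trans (owner-claim-≢ b o (f∉es ∘ here ∘ sym)) (sym (owner-claim-≢ b o′ p≢e)))

_∈ₑ?_ : (e : Edge n) (es : List (Edge n)) → Dec (e ∈ es)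
e ∈ₑ? es = Any.any? (e ≟ₑ_) es

length≤0 : {xs : List A} → length xs ≤ 0 → xs ≡ []
length≤0 {xs = []} _ = refl

weight-blo : (b : Board n) {e : Edge n} {es : List (Edge n)} → e ∈ es → owner b e ≡ blo →
  weight b es ≡ 0
weight-blo b (here refl) eq rewrite eq = refl
weight-blo b {es = p ∷ _} (there e∈es) eq rewrite weight-blo b e∈es eq = *-zeroʳ (ω (owner b p))

ω≤2 : ∀ o → ω o ≤ 2
ω≤2 con  = ≤-refl
ω≤2 free = s≤s z≤n
ω≤2 blo  = z≤n

-- `con` carries the largest value of `ω`, so overwriting any owner by it lowers no factor.
weight-≤-claim-con : (b : Board n) (e : Edge n) (es : List (Edge n)) →
  weight b es ≤ weight (claim b e con) es
weight-≤-claim-con b e []       = ≤-refl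
weight-≤-claim-con b e (p ∷ es) = *-mono-≤ ω≤ (weight-≤-claim-con b e es)
  where
  ω≤ : ω (owner b p) ≤ ω (owner (claim b e con) p)
  ω≤ with p ≟ₑ e
  ... | yes refl rewrite owner-claim-≡ b e con      = ω≤2 (owner b p)
  ... | no p≢e   rewrite owner-claim-≢ b con p≢e = ≤-refl

-- The free value 1 is the mean of 2 and 0, and a product over distinct edges is affine in each
-- factor.
weight-con+blo : (b : Board n) {e : Edge n} {es : List (Edge n)} → owner b e ≡ free → Unique es →
  weight (claim b e con) es + weight (claim b e blo) es ≡ 2 * weight b es
weight-con+blo b {e} e-free [] = refl
weight-con+blo b {e} {p ∷ es} e-free (p∉es ∷ es!) with p ≟ₑ e
... | yes refl
  rewrite owner-claim-≡ b e con | owner-claim-≡ b e blo | e-free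
        | weight-claim-∉ b con es (λ e∈es → All.lookup p∉es e∈es refl) = double (weight b es)
  where
  double : ∀ w → 2 * w + 0 ≡ 2 * (1 * w)
  double = solve-∀
... | no p≢e
  rewrite owner-claim-≢ b con p≢e | owner-claim-≢ b blo p≢e =
  trans (sym (*-distribˡ-+ (ω (owner b p)) _ _))
  (trans (cong (ω (owner b p) *_) (weight-con+blo b e-free es!)) (swap (ω (owner b p)) (weight b es)))
  where
  swap : ∀ a w → a * (2 * w) ≡ 2 * (a * w)
  swap = solve-∀

weight-≤8 : (b : Board n) (T : Triple n) → weight b (edgesOf T) ≤ 8
weight-≤8 b (i , j , k) =
  *-mono-≤ (ω≤2 (b i j)) (*-mono-≤ (ω≤2 (b j k)) (*-mono-≤ (ω≤2 (b i k)) ≤-refl))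

-- If `f` lies in `es`, both weights after Blocker's claim vanish and monotonicity in `e` remains.
-- Otherwise that claim is invisible and equality holds.
weight-blo-con : (b : Board n) {e f : Edge n} → e ≢ f → (es : List (Edge n)) →
  weight (claim (claim b f blo) e con) es + weight b es ≤
  weight (claim b f blo) es + weight (claim b e con) es
weight-blo-con b {e} {f} e≢f es with f ∈ₑ? es
... | yes f∈es
  rewrite weight-blo (claim (claim b f blo) e con) f∈es
            (trans (owner-claim-≢ (claim b f blo) con (e≢f ∘ sym)) (owner-claim-≡ b f blo)) =
  m≤n⇒m≤o+n _ (weight-≤-claim-con b e es)
... | no f∉es
  rewrite weight-claim-∉ b blo es f∉es | weight-claim-claim-∉ b blo e con es f∉es =
  ≤-reflexive (+-comm (weight (claim b e con) es) _)

-- Where one of the two claims is invisible, the effects of both simply add up, with equality.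
weight-con-blo : (b : Board n) (e f : Edge n) (es : List (Edge n)) → e ∉ es ⊎ f ∉ es →
  weight (claim b e con) es + weight (claim b f blo) es ≤
  weight (claim (claim b e con) f blo) es + weight b es
weight-con-blo b e f es (inj₁ e∉es)
  rewrite weight-claim-∉ b con es e∉es | weight-claim-claim-∉ b con f blo es e∉es =
  ≤-reflexive (+-comm (weight b es) _)
weight-con-blo b e f es (inj₂ f∉es)
  rewrite weight-claim-∉ b blo es f∉es | weight-claim-∉ (claim b e con) blo es f∉es = ≤-refl

-- How one or two claims change the potential.

_≟ₜ_ : DecidableEquality (Triple n)
_≟ₜ_ = ≡-dec _≟_ (≡-dec _≟_ _≟_)

Φ+Φ : (b c : Board n) →
  ∑ (triples n) (λ T → weight b (edgesOf T) + weight c (edgesOf T)) ≡ Φ b + Φ c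
Φ+Φ {n} b c = ∑-+ (triples n) (weight b ∘ edgesOf) (weight c ∘ edgesOf)

Φ-≤-claim-con : (b : Board n) (e : Edge n) → Φ b ≤ Φ (claim b e con)
Φ-≤-claim-con {n} b e = ∑-mono (triples n) λ {T} _ → weight-≤-claim-con b e (edgesOf T)

-- Constructor's gain at `e` equals Blocker's gain there, both being `D(e)`; the sum form avoids
-- subtraction.
Φ-con+blo : (b : Board n) {e : Edge n} → owner b e ≡ free →
  Φ (claim b e con) + Φ (claim b e blo) ≡ Φ b + Φ b
Φ-con+blo {n} b {e} e-free = trans (sym (Φ+Φ (claim b e con) (claim b e blo)))
  (trans (∑-cong (triples n) λ {T} T∈ → trans
    (weight-con+blo b e-free (edgesOf-unique T∈))
    (cong (weight b (edgesOf T) +_) (+-identityʳ _)))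
  (Φ+Φ b b))

-- In terms of increments: `D(e)` does not grow when Blocker claims `f`.
Φ-blo-con : (b : Board n) {e f : Edge n} → e ≢ f →
  Φ (claim (claim b f blo) e con) + Φ b ≤ Φ (claim b f blo) + Φ (claim b e con)
Φ-blo-con {n} b {e} {f} e≢f = ≤-trans (≤-reflexive (sym (Φ+Φ (claim (claim b f blo) e con) b)))
  (≤-trans (∑-mono (triples n) λ {T} _ → weight-blo-con b e≢f (edgesOf T))
  (≤-reflexive (Φ+Φ (claim b f blo) (claim b e con))))

-- Only the boundedly many triangles through both edges contribute to the error term.
Φ-con-blo : (b : Board n) {e f : Edge n} → e ≢ f →
  Φ (claim b e con) + Φ (claim b f blo) ≤ Φ (claim (claim b e con) f blo) + Φ b + 96
Φ-con-blo {n} b {e} {f} e≢f =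
  ≤-trans (≤-reflexive (sym (Φ+Φ (claim b e con) (claim b f blo))))
  -- The two weights on the left are at most 8 each, hence 16; six exceptional triples give 96.
  (≤-trans (∑-≤-except _≟ₜ_ 16 (triples n) (completions e (proj₁ f ∷ proj₂ f ∷ [])) (triples-unique n)
    (λ {T} _ T∉ → weight-con-blo b e f (edgesOf T) (misses T T∉))
    (λ {T} _ → m≤n⇒m≤o+n _ (+-mono-≤ (weight-≤8 (claim b e con) T) (weight-≤8 (claim b f blo) T))))
  (≤-reflexive (cong (_+ 96) (Φ+Φ (claim (claim b e con) f blo) b))))
  where
  misses : ∀ T → T ∉ completions e (proj₁ f ∷ proj₂ f ∷ []) → e ∉ edgesOf T ⊎ f ∉ edgesOf T
  misses T T∉ with e ∈ₑ? edgesOf T | f ∈ₑ? edgesOf T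
  ... | no e∉  | _      = inj₁ e∉
  ... | yes _  | no f∉  = inj₂ f∉
  ... | yes e∈ | yes f∈ = contradiction (∈-completions-edge e≢f e∈ f∈) T∉

-- Only triples through `e` change. At most `n * 3` are listed, each of weight at most 8.
Φ-claim-con-≤ : (b : Board n) (e : Edge n) → Φ (claim b e con) ≤ Φ b + n * 3 * 8
Φ-claim-con-≤ {n} b e = ≤-trans
  (∑-≤-except _≟ₜ_ 8 (triples n) (completions e (allFin n)) (triples-unique n)
    (λ {T} _ T∉ → ≤-reflexive (weight-claim-∉ b con (edgesOf T) (T∉ ∘ ∈-completions-allFin)))
    (λ {T} _ → m≤n⇒m≤o+n _ (weight-≤8 (claim b e con) T)))
  (≤-reflexive (cong (λ l → Φ b + l * 8)
    (trans (length-completions e (allFin n)) (cong (_* 3) (length-tabulate {n = n} id)))))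

-- Free edges, and the potential against the score.

∈-freeEdges⁻ : (b : Board n) {e : Edge n} → e ∈ freeEdges b → e ∈ edges n × owner b e ≡ free
∈-freeEdges⁻ {n} b {i , j} e∈ with e∈′ , eq ← ∈-filter⁻ _ {xs = edges n} e∈ with b i j
... | free = e∈′ , refl

∈-freeEdges⁺ : (b : Board n) {e : Edge n} → e ∈ edges n → owner b e ≡ free → e ∈ freeEdges b
∈-freeEdges⁺ b {i , j} e∈ eq = ∈-filter⁺ _ e∈ (cong isFree eq)

free-claim⁻ : (b : Board n) {e p : Edge n} {o : Owner} → o ≢ free → owner (claim b e o) p ≡ free →
  p ≢ e × owner b p ≡ free
free-claim⁻ b {e} {p} {o} o≢free p-free = p≢e , trans (sym (owner-claim-≢ b o p≢e)) p-free
  where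
  p≢e : p ≢ e
  p≢e refl = o≢free (trans (sym (owner-claim-≡ b e o)) p-free)

length-freeEdges-claim : (b : Board n) {e : Edge n} {o : Owner} → o ≢ free → e ∈ freeEdges b →
  length (freeEdges (claim b e o)) < length (freeEdges b)
length-freeEdges-claim {n} b {e} {o} o≢free e∈ with e∈edges , e-free ← ∈-freeEdges⁻ b e∈ =
  length-filter-< _ _ (λ {p} p-free → cong isFree (proj₂ (free-claim⁻ b {e} {p} o≢free (isFree⁻ p-free))))
    (edges n) e∈edges
    (λ e-free′ → proj₁ (free-claim⁻ b {e} {e} o≢free (isFree⁻ e-free′)) refl) (cong isFree e-free)
  where
  isFree⁻ : ∀ {o} → isFree o ≡ true → o ≡ free
  isFree⁻ {free} _ = refl

-- A triangle of Constructor weighs 2³ = 8, and the other weights are nonnegative.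
8*triangleCount≤Φ : (b : Board n) → 8 * triangleCount b ≤ Φ b
8*triangleCount≤Φ {n} b = *length-filter≤∑ _ 8 (triples n) λ {T} _ → full T
  where
  full : ∀ ((i , j , k) : Triple n) → isCon (b i j) ∧ isCon (b j k) ∧ isCon (b i k) ≡ true →
    8 ≤ weight b (edgesOf (i , j , k))
  full (i , j , k) eq with b i j | b j k | b i k
  ... | con | con | con = ≤-refl

-- With nothing free, every triple that is not Constructor's contains an edge of Blocker and weighs
-- 0.
Φ≤8*triangleCount : (b : Board n) → freeEdges b ≡ [] → Φ b ≤ 8 * triangleCount b
Φ≤8*triangleCount {n} b none = ∑≤*length-filter _ 8 (triples n)
  (λ {T} _ → weight-≤8 b T)
  (λ {T} T∈ ¬full → ≤-reflexive (vanishes T T∈ ¬full))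
  where
  claimed : ∀ {T e} → T ∈ triples n → e ∈ edgesOf T → owner b e ≢ free
  claimed T∈ e∈ e-free with () ← subst (_ ∈_) none (∈-freeEdges⁺ b (edgesOf⊆edges T∈ e∈) e-free)
  vanishes : ∀ ((i , j , k) : Triple n) → (i , j , k) ∈ triples n →
    ¬ (isCon (b i j) ∧ isCon (b j k) ∧ isCon (b i k) ≡ true) → weight b (edgesOf (i , j , k)) ≡ 0
  vanishes (i , j , k) T∈ ¬full
    -- The facts that no edge is free are abstracted along with the owners, so that each `free` case
    -- yields a refutable `free ≢ free`.
    with b i j | b j k | b i k
       | claimed T∈ (here refl) | claimed T∈ (there (here refl)) | claimed T∈ (there (there (here refl)))
  ... | free | _    | _    | c | _ | _ = contradiction refl c
  ... | blo  | _    | _    | _ | _ | _ = refl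
  ... | con  | free | _    | _ | c | _ = contradiction refl c
  ... | con  | blo  | _    | _ | _ | _ = refl
  ... | con  | con  | free | _ | _ | c = contradiction refl c
  ... | con  | con  | blo  | _ | _ | _ = refl
  ... | con  | con  | con  | _ | _ | _ = contradiction refl ¬full

Φ-empty : ∀ n → Φ (emptyBoard {n}) ≡ length (triples n)
Φ-empty n = ∑-1 (triples n)

-- Minimax values and greedy choices.

-- The maximum is attained by an entry, so any property common to all entries passes to it, be it an
-- upper or a lower bound.
maxList-elim : (P : ℕ → Set) (f : A → ℕ) (x : A) (xs : List A) →
  (∀ {y} → y ∈ x ∷ xs → P (f y)) → P (maxList (map f (x ∷ xs)))
maxList-elim P f x []       Pf = subst P (sym (⊔-identityʳ (f x))) (Pf (here refl))
maxList-elim P f x (y ∷ xs) Pf with ⊔-sel (f x) (maxList (map f (y ∷ xs)))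
... | inj₁ eq = subst P (sym eq) (Pf (here refl))
... | inj₂ eq = subst P (sym eq) (maxList-elim P f y xs (Pf ∘ there))

minList-elim : (P : ℕ → Set) (f : A → ℕ) (x : A) (xs : List A) →
  (∀ {y} → y ∈ x ∷ xs → P (f y)) → P (minList (map f (x ∷ xs)))
minList-elim P f x []       Pf = Pf (here refl)
minList-elim P f x (y ∷ xs) Pf with ⊓-sel (f x) (minList (map f (y ∷ xs)))
... | inj₁ eq = subst P (sym eq) (Pf (here refl))
... | inj₂ eq = subst P (sym eq) (minList-elim P f y xs (Pf ∘ there))

≤maxList : (f : A → ℕ) {x : A} {xs : List A} → x ∈ xs → f x ≤ maxList (map f xs)
≤maxList f (here refl)  = m≤m⊔n _ _
≤maxList f (there x∈xs) = m≤n⇒m≤o⊔n _ (≤maxList f x∈xs)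

minList≤ : (f : A → ℕ) {x : A} {xs : List A} → x ∈ xs → minList (map f xs) ≤ f x
minList≤ f {xs = _ ∷ []}     (here refl)  = ≤-refl
minList≤ f {xs = _ ∷ _ ∷ _} (here refl)  = m⊓n≤m _ _
minList≤ f {xs = _ ∷ _ ∷ _} (there x∈xs) = m≤n⇒o⊓m≤n _ (minList≤ f x∈xs)

module _ (legal : Board n → Bool) (score : Board n → ℕ) where

  -- The two elimination rules deal with arbitrary moves of the opponent and with positions without
  -- moves; the two bounds after them deal with the move a strategy chooses.
  value-Constructor-elim : (P : ℕ → Set) (f : ℕ) (b : Board n) → P (score b) →
    (∀ {e} → e ∈ legalConMoves legal b → P (value legal score f Blocker (claim b e con))) →
    P (value legal score (suc f) Constructor b)
  value-Constructor-elim P f b P-score P-move with legalConMoves legal b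
  ... | []     = P-score
  ... | e ∷ es = maxList-elim P _ e es P-move

  value-Blocker-elim : (P : ℕ → Set) (f : ℕ) (b : Board n) → (freeEdges b ≡ [] → P (score b)) →
    (∀ {e} → e ∈ freeEdges b → P (value legal score f Constructor (claim b e blo))) →
    P (value legal score (suc f) Blocker b)
  value-Blocker-elim P f b P-score P-move with freeEdges b
  ... | []     = P-score refl
  ... | e ∷ es = minList-elim P _ e es P-move

  ≤value-Constructor : (f : ℕ) (b : Board n) {e : Edge n} → e ∈ legalConMoves legal b →
    value legal score f Blocker (claim b e con) ≤ value legal score (suc f) Constructor b
  ≤value-Constructor f b e∈ with legalConMoves legal b
  ... | _ ∷ _ = ≤maxList (λ e → value legal score f Blocker (claim b e con)) e∈

  value-Blocker≤ : (f : ℕ) (b : Board n) {e : Edge n} → e ∈ freeEdges b →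
    value legal score (suc f) Blocker b ≤ value legal score f Constructor (claim b e blo)
  value-Blocker≤ f b e∈ with freeEdges b
  ... | _ ∷ _ = minList≤ (λ e → value legal score f Constructor (claim b e blo)) e∈

maximizer : (F : A → ℕ) (xs : List A) →
  xs ≡ [] ⊎ ∃ λ e → e ∈ xs × (∀ {x} → x ∈ xs → F x ≤ F e)
maximizer F []       = inj₁ refl
-- The default of `argmax` is the head `x`, so the result lies in the list in either case.
maximizer F (x ∷ xs) = inj₂ (argmax F x xs , [ here , there ]′ (argmax-sel F x xs) , λ where
  (here refl)  → f[⊥]≤f[argmax] {f = F} x xs
  (there y∈xs) → All.lookup (f[xs]≤f[argmax] x xs) y∈xs)

-- The greedy strategies of both players.

gameValue : ℕ → Player → Board n → ℕ
gameValue = value (λ _ → true) triangleCount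

legal⇒free : (b : Board n) {e : Edge n} → e ∈ legalConMoves (λ _ → true) b → e ∈ freeEdges b
legal⇒free b e∈ = proj₁ (∈-filter⁻ _ {xs = freeEdges b} e∈)

free⇒legal : (b : Board n) {e : Edge n} → e ∈ freeEdges b → e ∈ legalConMoves (λ _ → true) b
free⇒legal b e∈ = ∈-filter⁺ _ e∈ refl

-- Blocker claims an edge f maximizing Φ (claim b f con): what Constructor gains by her next
-- move is then at most what Blocker has just gained.
mutual
  Constructor-upper : ∀ t (b : Board n) {M : ℕ} → Φ b ≤ M →
    (∀ {e} → e ∈ freeEdges b → Φ (claim b e con) ≤ M) → 8 * gameValue t Constructor b ≤ M
  -- When no move follows, the score is that of `b` itself; hence `M` must bound `Φ b` as well.
  Constructor-upper zero    b Φ≤M _       = ≤-trans (8*triangleCount≤Φ b) Φ≤M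
  Constructor-upper (suc t) b {M} Φ≤M Φ-con≤M = value-Constructor-elim _ _ (λ v → 8 * v ≤ M) t b
    (≤-trans (8*triangleCount≤Φ b) Φ≤M)
    (λ {e} e∈ → ≤-trans (Blocker-upper t (claim b e con)) (Φ-con≤M (legal⇒free b e∈)))

  Blocker-upper : ∀ t (b : Board n) → 8 * gameValue t Blocker b ≤ Φ b
  Blocker-upper zero    b = 8*triangleCount≤Φ b
  Blocker-upper (suc t) b with maximizer (λ e → Φ (claim b e con)) (freeEdges b)
  ... | inj₁ none = value-Blocker-elim _ _ (λ v → 8 * v ≤ Φ b) t b (λ _ → 8*triangleCount≤Φ b)
    (λ e∈ → contradiction (subst (_ ∈_) none e∈) λ ())
  ... | inj₂ (f , f∈ , f-max) = ≤-trans (*-monoʳ-≤ 8 (value-Blocker≤ _ _ t b f∈))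
    (Constructor-upper t (claim b f blo) Φ-blo≤ Φ-blo-con≤)
    where
    balance : Φ (claim b f con) + Φ (claim b f blo) ≡ Φ b + Φ b
    balance = Φ-con+blo b (proj₂ (∈-freeEdges⁻ b f∈))
    Φ-blo≤ : Φ (claim b f blo) ≤ Φ b
    -- Constructor's claim of `f` cannot lower `Φ`, so by the balance Blocker's cannot raise it.
    Φ-blo≤ = +-cancelˡ-≤ (Φ b) _ _
      (≤-trans (+-monoˡ-≤ _ (Φ-≤-claim-con b f)) (≤-reflexive balance))
    Φ-blo-con≤ : ∀ {e} → e ∈ freeEdges (claim b f blo) → Φ (claim (claim b f blo) e con) ≤ Φ b
    Φ-blo-con≤ {e} e∈ with e∈edges , e-free ← ∈-freeEdges⁻ (claim b f blo) e∈
      with e≢f , e-free′ ← free-claim⁻ b {f} {e} (λ ()) e-free = +-cancelʳ-≤ (Φ b) _ _ (begin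
        Φ (claim (claim b f blo) e con) + Φ b     ≤⟨ Φ-blo-con b e≢f ⟩
        Φ (claim b f blo) + Φ (claim b e con)     ≤⟨ +-monoʳ-≤ _ (f-max (∈-freeEdges⁺ b e∈edges e-free′)) ⟩
        Φ (claim b f blo) + Φ (claim b f con)     ≡⟨ +-comm (Φ (claim b f blo)) _ ⟩
        Φ (claim b f con) + Φ (claim b f blo)     ≡⟨ balance ⟩
        Φ b + Φ b                                 ∎)
      where open ≤-Reasoning

-- Constructor claims an edge e maximizing Φ (claim b e con); Blocker's reply f then costs
-- at most what she has gained, up to the contribution of the triangles through e and f.
mutual
  Constructor-lower : ∀ t (b : Board n) → length (freeEdges b) ≤ t →
    Φ b ≤ 8 * gameValue t Constructor b + t * 96
  -- The fuel bounds the number of free edges, so at zero every edge is claimed and the potential is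
  -- settled.
  Constructor-lower zero    b free≤ = ≤-trans (Φ≤8*triangleCount b (length≤0 free≤)) (m≤m+n _ _)
  Constructor-lower (suc t) b free≤ with maximizer (λ e → Φ (claim b e con)) (freeEdges b)
  ... | inj₁ none = value-Constructor-elim _ _ (λ v → Φ b ≤ 8 * v + suc t * 96) t b
    (≤-trans (Φ≤8*triangleCount b none) (m≤m+n _ _))
    (λ e∈ → contradiction (subst (_ ∈_) none (legal⇒free b e∈)) λ ())
  ... | inj₂ (e , e∈ , e-max) = ≤-trans
    (Blocker-lower t b e e-max (s≤s⁻¹ (≤-trans (length-freeEdges-claim b (λ ()) e∈) free≤)))
    (+-monoˡ-≤ _ (*-monoʳ-≤ 8 (≤value-Constructor _ _ t b (free⇒legal b e∈))))

  Blocker-lower : ∀ t (b : Board n) (e : Edge n) →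
    (∀ {f} → f ∈ freeEdges b → Φ (claim b f con) ≤ Φ (claim b e con)) →
    length (freeEdges (claim b e con)) ≤ t →
    Φ b ≤ 8 * gameValue t Blocker (claim b e con) + suc t * 96
  -- Constructor made the last claim, so her gain stands without a reply.
  Blocker-lower zero b e e-max free≤ = ≤-trans
    (≤-trans (Φ-≤-claim-con b e) (Φ≤8*triangleCount (claim b e con) (length≤0 free≤))) (m≤m+n _ _)
  Blocker-lower (suc t) b e e-max free≤ =
    value-Blocker-elim _ _ (λ v → Φ b ≤ 8 * v + suc (suc t) * 96) t b₁
      (λ none → ≤-trans (≤-trans (Φ-≤-claim-con b e) (Φ≤8*triangleCount b₁ none)) (m≤m+n _ _))
      (λ {f} f∈ → begin
        Φ b                                                         ≤⟨ round f∈ ⟩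
        Φ (claim b₁ f blo) + 96
          ≤⟨ +-monoˡ-≤ 96 (Constructor-lower t (claim b₁ f blo)
            (s≤s⁻¹ (≤-trans (length-freeEdges-claim b₁ (λ ()) f∈) free≤))) ⟩
        -- A round loses 96 once but uses two units of fuel; the second 96 is given away to keep the
        -- error linear in the fuel.
        8 * gameValue t Constructor (claim b₁ f blo) + t * 96 + 96  ≤⟨ m≤m+n _ 96 ⟩
        8 * gameValue t Constructor (claim b₁ f blo) + t * 96 + 96 + 96
          ≡⟨ regroup (gameValue t Constructor (claim b₁ f blo)) t ⟩
        8 * gameValue t Constructor (claim b₁ f blo) + suc (suc t) * 96 ∎)
    where
    open ≤-Reasoning
    b₁ = claim b e con
    regroup : ∀ v t → 8 * v + t * 96 + 96 + 96 ≡ 8 * v + suc (suc t) * 96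
    regroup = solve-∀
    swap : ∀ x y → x + y + 96 ≡ x + 96 + y
    swap = solve-∀
    round : ∀ {f} → f ∈ freeEdges b₁ → Φ b ≤ Φ (claim b₁ f blo) + 96
    round {f} f∈ with f∈edges , f-free ← ∈-freeEdges⁻ b₁ f∈
      with f≢e , f-free′ ← free-claim⁻ b {e} {f} (λ ()) f-free = +-cancelʳ-≤ (Φ b) _ _ (begin
        Φ b + Φ b                               ≡⟨ Φ-con+blo b f-free′ ⟨
        -- The reply `f` was already free before `e` was claimed, so the maximality of `e` covers
        -- it.
        Φ (claim b f con) + Φ (claim b f blo)   ≤⟨ +-monoˡ-≤ _ (e-max (∈-freeEdges⁺ b f∈edges f-free′)) ⟩
        Φ b₁ + Φ (claim b f blo)                ≤⟨ Φ-con-blo b (f≢e ∘ sym) ⟩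
        Φ (claim b₁ f blo) + Φ b + 96           ≡⟨ swap (Φ (claim b₁ f blo)) (Φ b) ⟩
        Φ (claim b₁ f blo) + 96 + Φ b           ∎)

-- Explicit bounds and the limit.

-- Each later claim of Constructor is paid for by Blocker's claim before it. Her first has none
-- before it, which accounts for `24 * n`.
8*g≤ : ∀ n → 8 * gTriangleEmpty n ≤ length (triples n) + 24 * n
8*g≤ n = ≤-trans
  (Constructor-upper (length (edges n)) emptyBoard (m≤m+n _ (n * 3 * 8))
    (λ {e} _ → Φ-claim-con-≤ emptyBoard e))
  (≤-reflexive (cong₂ _+_ (Φ-empty n) (shift n)))
  where
  shift : ∀ n → n * 3 * 8 ≡ 24 * n
  shift = solve-∀

-- `Constructor-lower` loses 96 per unit of fuel, and the fuel is the number of edges.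
≤8*g : ∀ n → length (triples n) ≤ 8 * gTriangleEmpty n + 96 * (n * n)
≤8*g n = begin
  length (triples n)                                  ≡⟨ Φ-empty n ⟨
  Φ (emptyBoard {n})
    ≤⟨ Constructor-lower (length (edges n)) emptyBoard (length-filter _ (edges n)) ⟩
  8 * gTriangleEmpty n + length (edges n) * 96        ≤⟨ +-monoʳ-≤ _ (*-monoˡ-≤ 96 (length-edges-≤ n)) ⟩
  8 * gTriangleEmpty n + n * n * 96                   ≡⟨ cong (8 * gTriangleEmpty n +_) (*-comm (n * n) 96) ⟩
  8 * gTriangleEmpty n + 96 * (n * n)                 ∎
  where open ≤-Reasoning

n≤n*n : ∀ n → n ≤ n * n
n≤n*n zero    = z≤n
n≤n*n (suc n) = m≤m*n (suc n) (suc n)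

6*length-triples : ∀ n → 6 * length (triples n) + 3 * (n * n) ≡ n * (n * n) + 2 * n
6*length-triples n = trans (cong (λ l → 6 * l + 3 * (n * n)) (length-triples n)) (6*∑-countPairsAbove n)

48*g≤ : ∀ n → 48 * gTriangleEmpty n ≤ n ^ 3 + 579 * (n * n)
48*g≤ n = begin
  48 * g                                  ≡⟨ *-assoc 6 8 g ⟩
  6 * (8 * g)                             ≤⟨ *-monoʳ-≤ 6 (8*g≤ n) ⟩
  6 * (N + 24 * n)                        ≤⟨ m≤m+n _ (3 * (n * n)) ⟩
  6 * (N + 24 * n) + 3 * (n * n)          ≡⟨ regroup N n ⟩
  6 * N + 3 * (n * n) + 144 * n           ≡⟨ cong (_+ 144 * n) (6*length-triples n) ⟩
  n * (n * n) + 2 * n + 144 * n           ≡⟨ collect n ⟩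
  -- Here 146 = 2 + 6 * 24 is raised to 579 = 6 * 96 + 3, the constant arising in `n^3≤`, so that
  -- both bounds share one error term.
  n ^ 3 + 146 * n                         ≤⟨ +-monoʳ-≤ (n ^ 3) (*-mono-≤ (m≤m+n 146 433) (n≤n*n n)) ⟩
  n ^ 3 + 579 * (n * n)                   ∎
  where
  open ≤-Reasoning
  g = gTriangleEmpty n
  N = length (triples n)
  regroup : ∀ N n → 6 * (N + 24 * n) + 3 * (n * n) ≡ 6 * N + 3 * (n * n) + 144 * n
  regroup = solve-∀
  collect : ∀ n → n * (n * n) + 2 * n + 144 * n ≡ n * (n * (n * 1)) + 146 * n
  collect = solve-∀

n^3≤ : ∀ n → n ^ 3 ≤ 48 * gTriangleEmpty n + 579 * (n * n)
n^3≤ n = begin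
  n ^ 3                                   ≡⟨ cube n ⟩
  n * (n * n)                             ≤⟨ m≤m+n _ (2 * n) ⟩
  n * (n * n) + 2 * n                     ≡⟨ 6*length-triples n ⟨
  6 * N + 3 * (n * n)                     ≤⟨ +-monoˡ-≤ _ (*-monoʳ-≤ 6 (≤8*g n)) ⟩
  6 * (8 * g + 96 * (n * n)) + 3 * (n * n) ≡⟨ regroup g (n * n) ⟩
  48 * g + 579 * (n * n)                  ∎
  where
  open ≤-Reasoning
  g = gTriangleEmpty n
  N = length (triples n)
  cube : ∀ n → n * (n * (n * 1)) ≡ n * (n * n)
  cube = solve-∀
  regroup : ∀ g s → 6 * (8 * g + 96 * s) + 3 * s ≡ 48 * g + 579 * s
  regroup = solve-∀

∣-∣≤ : ∀ {x y d} → x ≤ y + d → y ≤ x + d → ∣ x - y ∣ ≤ d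
∣-∣≤ {x} {y} x≤y+d y≤x+d with ∣m-n∣≡[m∸n]∨[n∸m] x y
... | inj₁ eq = ≤-trans (≤-reflexive eq) (m≤n+o⇒m∸n≤o _ _ x≤y+d)
... | inj₂ eq = ≤-trans (≤-reflexive eq) (m≤n+o⇒m∸n≤o _ _ y≤x+d)

-- The factor 1 + o(1) without division: for each `k` the relative error is eventually at most
-- 1/(k+1).
theorem1p1 : (k : ℕ) → Σ ℕ (λ N → (n : ℕ) → N ≤ n →
    suc k * ∣ 48 * gTriangleEmpty n - n ^ 3 ∣ ≤ n ^ 3)
-- From this threshold on, one factor `n` of the cube absorbs `suc k * 579`.
theorem1p1 k = suc k * 579 , λ n N≤n → begin
  suc k * ∣ 48 * gTriangleEmpty n - n ^ 3 ∣  ≤⟨ *-monoʳ-≤ (suc k) (∣-∣≤ (48*g≤ n) (n^3≤ n)) ⟩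
  suc k * (579 * (n * n))                    ≡⟨ *-assoc (suc k) 579 (n * n) ⟨
  suc k * 579 * (n * n)                      ≤⟨ *-monoˡ-≤ (n * n) N≤n ⟩
  n * (n * n)                                ≡⟨ cong (λ m → n * (n * m)) (*-identityʳ n) ⟨
  n ^ 3                                      ∎
  where open ≤-Reasoning
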